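{- Let $\Gamma$ be an s-theory. If every finite subset of $\Gamma$ is satisfiable (i.e. satisfied by some frame), then $\Gamma$ is satisfiable (i.e. there is a single frame that satisfies every s-formula in $\Gamma$).
   Context: Fix an infinite (possibly uncountable) set $\Sigma$ of propositional variables. Propositional formulas are built from $\Sigma$ using $\lnot$, $\land$, $\lor$, $\to$. An s-formula is an expression of the form $A \prec B$ (a strict implication) or $A \not\prec B$ (a strict nonimplication), where $A$ and $B$ are propositional formulas; here $\prec$ and $\not\prec$ are two formal symbols, and they are not nested. An s-theory is an arbitrary (possibly infinite) set of s-formulas. A valuation is a function $w:\Sigma\to\{T,F\}$, extended in the usual way to all propositional formulas. A frame is a nonempty set of valuations. A frame $R$ satisfies $A \prec B$ if for every $w\in R$, $w(A\to B)=T$ (equivalently $w(A)=F$ or $w(B)=T$). A frame $R$ satisfies $A\not\prec B$ if there is at least one $w\in R$ with $w(A)=T$ and $w(B)=F$. A frame satisfies an s-theory if it satisfies every formula in it; an s-theory is satisfiable if some frame satisfies it. -}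

module Defs where

open import Level using (Level; suc)
open import Data.Bool.Base using (Bool; true; false; not; _∧_; _∨_)
open import Data.Fin.Base using (Fin)
open import Data.List.Base using (List)
open import Data.List.Membership.Propositional using () renaming (_∈_ to _∈ᴸ_)
open import Data.Product.Base using (∃; ∃-syntax; _×_)
open import Function.Bundles using (_↔_)
open import Relation.Binary.PropositionalEquality.Core using (_≡_)
open import Relation.Nullary.Negation.Core using (¬_)
open import Relation.Unary using (Pred; _∈_; _≐_)

private
  variable
    ℓ : Level

Infinite : Set ℓ → Set ℓ
Infinite A = ¬ (∃[ n ] (Fin n ↔ A))

FiniteSubset : {A : Set ℓ} → Pred A ℓ → Set ℓ
FiniteSubset {A = A} P = ∃ λ (xs : List A) → P ≐ (_∈ᴸ xs)

infix  9 ¬̇_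
infixr 8 _∧̇_
infixr 7 _∨̇_
infixr 6 _→̇_
infix  5 _≺_ _⊀_

data Formula (Var : Set ℓ) : Set ℓ where
  var  : Var → Formula Var
  ¬̇_   : Formula Var → Formula Var
  _∧̇_  : Formula Var → Formula Var → Formula Var
  _∨̇_  : Formula Var → Formula Var → Formula Var
  _→̇_  : Formula Var → Formula Var → Formula Var

data SFormula (Var : Set ℓ) : Set ℓ where
  _≺_ : Formula Var → Formula Var → SFormula Var
  _⊀_ : Formula Var → Formula Var → SFormula Var

STheory : Set ℓ → Set (suc ℓ)
STheory {ℓ} Var = Pred (SFormula Var) ℓ

Valuation : Set ℓ → Set ℓ
Valuation Var = Var → Bool

⟦_⟧ : {Var : Set ℓ} → Formula Var → Valuation Var → Bool
⟦ var p ⟧  w = w p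
⟦ ¬̇ A ⟧    w = not (⟦ A ⟧ w)
⟦ A ∧̇ B ⟧  w = ⟦ A ⟧ w ∧ ⟦ B ⟧ w
⟦ A ∨̇ B ⟧  w = ⟦ A ⟧ w ∨ ⟦ B ⟧ w
⟦ A →̇ B ⟧  w = not (⟦ A ⟧ w) ∨ ⟦ B ⟧ w

record Frame (Var : Set ℓ) : Set (suc ℓ) where
  field
    worlds   : Pred (Valuation Var) ℓ
    nonempty : ∃[ w ] w ∈ worlds

open Frame public

infix 4 _⊨_ _⊨ᵀ_

_⊨_ : {Var : Set ℓ} → Frame Var → SFormula Var → Set ℓ
R ⊨ (A ≺ B) = ∀ w → w ∈ worlds R → ⟦ A →̇ B ⟧ w ≡ true
R ⊨ (A ⊀ B) = ∃[ w ] (w ∈ worlds R × ⟦ A ⟧ w ≡ true × ⟦ B ⟧ w ≡ false)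

_⊨ᵀ_ : {Var : Set ℓ} → Frame Var → STheory Var → Set ℓ
R ⊨ᵀ Γ = ∀ φ → φ ∈ Γ → R ⊨ φ

Satisfiable : {Var : Set ℓ} → STheory Var → Set (suc ℓ)
Satisfiable {Var = Var} Γ = ∃ λ (R : Frame Var) → R ⊨ᵀ Γ

{-# OPTIONS --safe #-}

-- A frame for Γ exists as soon as, for every A ⊀ B in Γ, some valuation makes A true,
-- B false and C → D true for each C ≺ D in Γ: all valuations respecting the strict
-- implications of Γ then form a frame. Such a valuation is provided by propositional
-- compactness, applied to a maximal set of literals compatible with every finite part
-- of the theory. The maximal set comes from the Teichmüller–Tukey lemma, proved by
-- Zermelo's tower construction; representing subsets as Bool-valued functions keeps
-- the whole tower in Set ℓ, where excluded middle is available.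
module Submission where

open import Defs
open import Axiom.ExcludedMiddle using (ExcludedMiddle)
open import Axiom.Extensionality.Propositional using (Extensionality; lower-extensionality)
open import Relation.Unary using (_⊆_)

open import Level using (Level; 0ℓ)
open import Data.Bool.Base using (Bool; true; false; not; _∧_; _∨_)
open import Data.Bool.Properties using (⇔→≡; ∨-zeroʳ; not-injective)
open import Data.List.Base using (List; []; _∷_; _++_)
open import Data.List.Membership.Propositional using () renaming (_∈_ to _∈ᴸ_)
open import Data.List.Relation.Binary.Subset.Propositional using () renaming (_⊆_ to _⊆ᴸ_)
open import Data.List.Relation.Binary.Subset.Propositional.Properties using (∷⁺ʳ; xs⊆x∷xs; ⊆-trans; ∈-∷⁺ʳ)
open import Data.List.Relation.Unary.All as All using (All; []; _∷_)
open import Data.List.Relation.Unary.All.Properties using (++⁺; ++⁻; anti-mono)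
open import Data.List.Relation.Unary.Any using (here; there)
open import Data.Product.Base using (∃; _×_; _,_; proj₁; proj₂)
open import Data.Sum.Base using (_⊎_; inj₁; inj₂)
open import Function.Base using (id; _∘_)
open import Function.Bundles using (mk⇔)
open import Relation.Binary.PropositionalEquality
  using (_≡_; refl; sym; trans; cong; cong₂; subst)
open import Relation.Nullary.Decidable using (Dec; yes; no; does; dec-true; decidable-stable)
open import Relation.Nullary.Negation using (¬_; contradiction)
open import Relation.Unary using (Pred; _∈_)

private
  variable
    ℓ : Level

does-true⁻ : {P : Set ℓ} (P? : Dec P) → does P? ≡ true → P
does-true⁻ (yes p) _ = p

-- The Teichmüller-Tukey lemma.

module Tukey (em : ExcludedMiddle ℓ) (ext : Extensionality ℓ ℓ) {X : Set ℓ}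
  (Good : Pred (List X) ℓ) (good-[] : Good [])
  (good-⊆ : ∀ {xs ys} → xs ⊆ᴸ ys → Good ys → Good xs)
  where

  Subset : Set ℓ
  Subset = X → Bool

  infix 4 _∋_ _⊑_

  _∋_ : Subset → X → Set
  s ∋ x = s x ≡ true

  _⊑_ : Subset → Subset → Set ℓ
  s ⊑ t = ∀ x → s ∋ x → t ∋ x

  ⊑-antisym : ∀ {s t} → s ⊑ t → t ⊑ s → s ≡ t
  ⊑-antisym s⊑t t⊑s =
    lower-extensionality 0ℓ _ ext λ x → ⇔→≡ (mk⇔ (s⊑t x) (t⊑s x))

  ⋃ : (Subset → Bool) → Subset
  ⋃ P x = does (em {∃ λ s → P s ≡ true × s ∋ x})

  ⊑-⋃ : ∀ P {s} → P s ≡ true → s ⊑ ⋃ P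
  ⊑-⋃ P {s} Ps x sx = dec-true em (s , Ps , sx)

  ⋃-elim : ∀ P {x} → ⋃ P ∋ x → ∃ λ s → P s ≡ true × s ∋ x
  ⋃-elim P = does-true⁻ em

  insert : X → Subset → Subset
  insert x s y = s y ∨ does (em {y ≡ x})

  ⊑-insert : ∀ x s → s ⊑ insert x s
  ⊑-insert x s y sy = cong (_∨ does (em {y ≡ x})) sy

  insert-∋ : ∀ x s → insert x s ∋ x
  insert-∋ x s = trans (cong (s x ∨_) (dec-true em refl)) (∨-zeroʳ (s x))

  insert-elim : ∀ x s {y} → insert x s ∋ y → s ∋ y ⊎ y ≡ x
  insert-elim x s {y} eq with s y
  ... | true  = inj₁ refl
  ... | false = inj₂ (does-true⁻ em eq)

  Consistent : Subset → Set ℓ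
  Consistent s = ∀ xs → All (s ∋_) xs → Good xs

  -- Entries outside `s` all equal `x`. Setting them aside leaves a list `x ∷ zs` with `zs` drawn
  -- from `s`, the form in which `tukey` states maximality.
  insert-split : ∀ x s {xs} → All (insert x s ∋_) xs →
    ∃ λ zs → All (s ∋_) zs × xs ⊆ᴸ x ∷ zs
  insert-split x s [] = [] , [] , λ ()
  insert-split x s (px ∷ pxs) with insert-split x s pxs | insert-elim x s px
  ... | zs , s∋zs , xs⊆ | inj₁ sy   =
    _ ∷ zs , sy ∷ s∋zs ,
    ∈-∷⁺ʳ (there (here refl)) (⊆-trans xs⊆ (∷⁺ʳ x (xs⊆x∷xs zs _)))
  ... | zs , s∋zs , xs⊆ | inj₂ refl = zs , s∋zs , ∈-∷⁺ʳ (here refl) xs⊆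

  -- Asking for `s x ≡ false` makes the extension strict, so a set closed under `next` admits none.
  Extension : Subset → Set ℓ
  Extension s = ∃ λ x → s x ≡ false × Consistent (insert x s)

  extend : ∀ s → Dec (Extension s) → Subset
  extend s (yes (x , _)) = insert x s
  extend s (no _)        = s

  next : Subset → Subset
  next s = extend s em

  ⊑-next : ∀ s → s ⊑ next s
  ⊑-next s with em {Extension s}
  ... | yes (x , _) = ⊑-insert x s
  ... | no _        = λ _ → id

  next-consistent : ∀ s → Consistent s → Consistent (next s)
  next-consistent s con with em {Extension s}
  ... | yes (_ , _ , con′) = con′
  ... | no _               = con

  next-closed⇒maximal : ∀ s → next s ⊑ s → ¬ Extension s
  next-closed⇒maximal s next⊑ e with em {Extension s}
  ... | no ¬e = ¬e e
  ... | yes (x , s∌x , _) with () ← trans (sym s∌x) (next⊑ x (insert-∋ x s))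

  -- `sup` takes arbitrary families: the empty one yields the starting point, and that the tower is
  -- a chain is proved afterwards.
  data Tower : Subset → Set ℓ where
    step : ∀ {s} → Tower s → Tower (next s)
    sup  : ∀ P → (∀ s → P s ≡ true → Tower s) → Tower (⋃ P)

  -- Once `R s t` holds for a fixed `s` and all `t` in the tower, an inner induction on `t` gives
  -- `R t s`, so the successor step may assume both.
  tower-double-induction : (R : Subset → Subset → Set ℓ) →
    (∀ {s t} → R s t → R t s → R (next s) t) →
    (∀ P {t} → (∀ s → P s ≡ true → R s t) → R (⋃ P) t) →
    ∀ {s} → Tower s → ∀ {t} → Tower t → R s t
  tower-double-induction R R-next R-⋃ = outer
    where
    inner : ∀ {s} → (∀ {t} → Tower t → R s t) → ∀ {t} → Tower t → R t s
    inner Rs (step τ)  = R-next (inner Rs τ) (Rs τ)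
    inner Rs (sup P τ) = R-⋃ P λ t Pt → inner Rs (τ t Pt)

    outer : ∀ {s} → Tower s → ∀ {t} → Tower t → R s t
    outer (step σ)  τ = R-next (outer σ τ) (inner (outer σ) τ)
    outer (sup P σ) τ = R-⋃ P λ s Ps → outer (σ s Ps) τ

  -- Leaving no gap between `t` and `next t` makes the induction close: if `s ⊑ t`, the swapped
  -- hypothesis yields `next s ⊑ t` unless `s` and `t` coincide.
  tower-successor : ∀ {s} → Tower s → ∀ {t} → Tower t → s ⊑ t ⊎ next t ⊑ s
  tower-successor = tower-double-induction R R-next R-⋃
    where
    R : Subset → Subset → Set ℓ
    R s t = s ⊑ t ⊎ next t ⊑ s

    R-next : ∀ {s t} → R s t → R t s → R (next s) t
    R-next         _            (inj₂ ns⊑t) = inj₁ ns⊑t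
    R-next {s}     (inj₂ nt⊑s)  (inj₁ _)    = inj₂ λ x → ⊑-next s x ∘ nt⊑s x
    R-next {s} {t} (inj₁ s⊑t)   (inj₁ t⊑s)  =
      inj₂ (subst (λ r → next r ⊑ next s) (⊑-antisym s⊑t t⊑s) λ _ → id)

    R-⋃ : ∀ P {t} → (∀ s → P s ≡ true → R s t) → R (⋃ P) t
    R-⋃ P {t} Rt with em {∃ λ s → P s ≡ true × next t ⊑ s}
    ... | yes (s , Ps , nt⊑s) = inj₂ λ x → ⊑-⋃ P Ps x ∘ nt⊑s x
    ... | no none = inj₁ below
      where
      below : ⋃ P ⊑ t
      below x ⋃x with ⋃-elim P ⋃x
      ... | s , Ps , sx with Rt s Ps
      ...   | inj₁ s⊑t  = s⊑t x sx
      ...   | inj₂ nt⊑s = contradiction (s , Ps , nt⊑s) none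

  tower-linear : ∀ {s t} → Tower s → Tower t → s ⊑ t ⊎ t ⊑ s
  tower-linear {t = t} σ τ with tower-successor σ τ
  ... | inj₁ s⊑t  = inj₁ s⊑t
  ... | inj₂ nt⊑s = inj₂ λ x → nt⊑s x ∘ ⊑-next t x

  -- The family is a chain, so finitely many points of its union fit into one member. The given `s`
  -- settles the empty list and keeps a point chosen earlier inside the result.
  ⋃-capture : ∀ P → (∀ s → P s ≡ true → Tower s) →
    ∀ {s} → P s ≡ true → ∀ {xs} → All (⋃ P ∋_) xs →
    ∃ λ t → P t ≡ true × s ⊑ t × All (t ∋_) xs
  ⋃-capture P τ {s} Ps [] = s , Ps , (λ _ → id) , []
  ⋃-capture P τ Ps (px ∷ pxs) with ⋃-capture P τ Ps pxs | ⋃-elim P px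
  ... | t , Pt , s⊑t , t∋xs | r , Pr , rx with tower-linear (τ t Pt) (τ r Pr)
  ...   | inj₁ t⊑r = r , Pr , (λ x → t⊑r x ∘ s⊑t x) , rx ∷ All.map (t⊑r _) t∋xs
  ...   | inj₂ r⊑t = t , Pt , s⊑t , r⊑t _ rx ∷ t∋xs

  tower-consistent : ∀ {s} → Tower s → Consistent s
  tower-consistent (step τ) = next-consistent _ (tower-consistent τ)
  -- The family may be empty, so no member is at hand here.
  tower-consistent (sup P τ) [] _ = good-[]
  tower-consistent (sup P τ) (x ∷ xs) (px ∷ pxs) with ⋃-elim P px
  ... | s , Ps , sx with ⋃-capture P τ Ps pxs
  ...   | t , Pt , s⊑t , t∋xs = tower-consistent (τ t Pt) (x ∷ xs) (s⊑t x sx ∷ t∋xs)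

  tukey : ∃ λ s → Consistent s ×
    (∀ x → (∀ xs → All (s ∋_) xs → Good (x ∷ xs)) → s ∋ x)
  tukey = top , tower-consistent top-tower , maximal
    where
    inTower : Subset → Bool
    inTower s = does (em {Tower s})

    top : Subset
    top = ⋃ inTower

    top-tower : Tower top
    top-tower = sup inTower λ _ → does-true⁻ em

    no-extension : ¬ Extension top
    -- The tower is closed under `next`, so `next top` is among the sets whose union is `top`.
    no-extension = next-closed⇒maximal top (⊑-⋃ inTower (dec-true em (step top-tower)))

    maximal : ∀ x → (∀ xs → All (top ∋_) xs → Good (x ∷ xs)) → top ∋ x
    maximal x good with top x in eq
    ... | true  = refl
    ... | false = contradiction (x , eq , consistent) no-extension
      where
      consistent : Consistent (insert x top)
      consistent xs pxs with insert-split x top pxs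
      ... | zs , top∋zs , xs⊆ = good-⊆ xs⊆ (good zs top∋zs)

-- Propositional compactness.

infix 4 _⊩_

_⊩_ : {Var : Set ℓ} → Valuation Var → Formula Var → Set
w ⊩ φ = ⟦ φ ⟧ w ≡ true

Literal : Set ℓ → Set ℓ
Literal Var = Var × Bool

infix 4 _⊩ˡ_

_⊩ˡ_ : {Var : Set ℓ} → Valuation Var → Literal Var → Set
v ⊩ˡ (p , b) = v p ≡ b

-- Only the finitely many variables occurring in `φ` matter; the literals record their values under
-- `w`.
literal-support : {Var : Set ℓ} (w : Valuation Var) (φ : Formula Var) →
  ∃ λ ls → All (w ⊩ˡ_) ls × (∀ v → All (v ⊩ˡ_) ls → ⟦ φ ⟧ v ≡ ⟦ φ ⟧ w)
literal-support {Var = Var} w = go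
  where
  Supports : List (Literal Var) → Formula Var → Set _
  Supports ls φ = All (w ⊩ˡ_) ls × (∀ v → All (v ⊩ˡ_) ls → ⟦ φ ⟧ v ≡ ⟦ φ ⟧ w)

  binary : ∀ {A B C} (_⊕_ : Bool → Bool → Bool) →
    (∀ v → ⟦ C ⟧ v ≡ ⟦ A ⟧ v ⊕ ⟦ B ⟧ v) →
    (∃ λ ls → Supports ls A) → (∃ λ ls → Supports ls B) → ∃ λ ls → Supports ls C
  binary _⊕_ ⟦C⟧ (ks , w⊩ks , A≡) (ls , w⊩ls , B≡) =
    ks ++ ls , ++⁺ w⊩ks w⊩ls , λ v v⊩ → let v⊩ks , v⊩ls = ++⁻ ks v⊩ in
      trans (⟦C⟧ v) (trans (cong₂ _⊕_ (A≡ v v⊩ks) (B≡ v v⊩ls)) (sym (⟦C⟧ w)))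

  go : ∀ φ → ∃ λ ls → Supports ls φ
  go (var p) = (p , w p) ∷ [] , refl ∷ [] , λ { v (eq ∷ []) → eq }
  go (¬̇ A)   with go A
  ... | ls , w⊩ls , A≡ = ls , w⊩ls , λ v → cong not ∘ A≡ v
  go (A ∧̇ B) = binary {A} {B} {A ∧̇ B} _∧_ (λ _ → refl) (go A) (go B)
  go (A ∨̇ B) = binary {A} {B} {A ∨̇ B} _∨_ (λ _ → refl) (go A) (go B)
  go (A →̇ B) = binary {A} {B} {A →̇ B} (λ a b → not a ∨ b) (λ _ → refl) (go A) (go B)

compactness : ExcludedMiddle ℓ → Extensionality ℓ ℓ → {Var : Set ℓ}
  (T : Pred (Formula Var) ℓ) →
  (∀ φs → All T φs → ∃ λ v → All (v ⊩_) φs) →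
  ∃ λ w → ∀ φ → φ ∈ T → w ⊩ φ
compactness em ext {Var} T finSat = w , w⊩T
  where
  Compatible : List (Literal Var) → Set _
  Compatible ls = ∀ φs → All T φs → ∃ λ v → All (v ⊩ˡ_) ls × All (v ⊩_) φs

  compatible-[] : Compatible []
  compatible-[] φs Tφs with finSat φs Tφs
  ... | v , v⊩φs = v , [] , v⊩φs

  compatible-⊆ : ∀ {ks ls} → ks ⊆ᴸ ls → Compatible ls → Compatible ks
  compatible-⊆ ks⊆ls comp φs Tφs with comp φs Tφs
  ... | v , v⊩ls , v⊩φs = v , anti-mono ks⊆ls v⊩ls , v⊩φs

  open Tukey em ext Compatible compatible-[] compatible-⊆ using (tukey; _∋_)

  u : Literal Var → Bool
  u = proj₁ tukey

  compatible-u : ∀ ls → All (u ∋_) ls → Compatible ls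
  compatible-u = proj₁ (proj₂ tukey)

  -- A finite certificate that `l` cannot join `u`; being finite, certificates for opposite literals
  -- can be merged.
  Refutation : Literal Var → Set _
  Refutation l = ∃ λ ls → All (u ∋_) ls × ∃ λ φs → All T φs ×
    (∀ v → All (v ⊩ˡ_) ls → All (v ⊩_) φs → ¬ (v ⊩ˡ l))

  member-or-refuted : ∀ l → u ∋ l ⊎ Refutation l
  member-or-refuted l with em {Refutation l}
  ... | yes r = inj₂ r
  ... | no ¬r = inj₁ (proj₂ (proj₂ tukey) l λ ls u∋ls φs Tφs →
    -- If `ls` and `φs` had no common model with `l`, they would form a refutation.
    decidable-stable em λ none →
      ¬r (ls , u∋ls , φs , Tφs , λ v v⊩ls v⊩φs v⊩l → none (v , v⊩l ∷ v⊩ls , v⊩φs)))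

  u-total : ∀ p → ∃ λ b → u ∋ (p , b)
  u-total p with member-or-refuted (p , true) | member-or-refuted (p , false)
  ... | inj₁ u∋ | _       = true , u∋
  ... | inj₂ _  | inj₁ u∋ = false , u∋
  ... | inj₂ (ks , u∋ks , φs , Tφs , ¬t) | inj₂ (ls , u∋ls , ψs , Tψs , ¬f)
    -- The merged refutations have a model by compatibility, yet either value of `p` in it is
    -- excluded by one of them.
    with compatible-u (ks ++ ls) (++⁺ u∋ks u∋ls) (φs ++ ψs) (++⁺ Tφs Tψs)
  ... | v , v⊩kls , v⊩φψs with ++⁻ ks v⊩kls | ++⁻ φs v⊩φψs | v p in eq
  ... | v⊩ks , _ | v⊩φs , _ | true  = contradiction eq (¬t v v⊩ks v⊩φs)
  ... | _ , v⊩ls | _ , v⊩ψs | false = contradiction eq (¬f v v⊩ls v⊩ψs)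

  w : Valuation Var
  w p = proj₁ (u-total p)

  w-literals⊆u : ∀ {l} → w ⊩ˡ l → u ∋ l
  w-literals⊆u {p , _} refl = proj₂ (u-total p)

  w⊩T : ∀ φ → φ ∈ T → w ⊩ φ
  w⊩T φ Tφ with literal-support w φ
  ... | ls , w⊩ls , φ≡
    -- The supporting literals belong to `u`, hence have a common model with `φ` itself, and that
    -- model agrees with `w` on `φ`.
    with compatible-u ls (All.map w-literals⊆u w⊩ls) (φ ∷ []) (Tφ ∷ [])
  ... | v , v⊩ls , v⊩φ ∷ [] = trans (sym (φ≡ v v⊩ls)) v⊩φ

-- Worlds for the frame.

Respects : {Var : Set ℓ} → STheory Var → Valuation Var → Set ℓ
Respects Γ w = ∀ A B → (A ≺ B) ∈ Γ → w ⊩ (A →̇ B)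

respects-compactness : ExcludedMiddle ℓ → Extensionality ℓ ℓ → {Var : Set ℓ}
  (Γ : STheory Var) (es : List (Formula Var)) →
  (∀ xs → All Γ xs → ∃ λ w → Respects (_∈ᴸ xs) w × All (w ⊩_) es) →
  ∃ λ w → Respects Γ w × All (w ⊩_) es
respects-compactness {ℓ} em ext {Var} Γ es finSat =
  w , (λ A B Γ∋ → w⊩ (A →̇ B) (inj₁ (A , B , Γ∋ , refl))) ,
  All.tabulate λ {φ} φ∈es → w⊩ φ (inj₂ φ∈es)
  where
  T : Pred (Formula Var) ℓ
  T φ = (∃ λ A → ∃ λ B → (A ≺ B) ∈ Γ × φ ≡ (A →̇ B)) ⊎ φ ∈ᴸ es

  -- Formulas coming from strict implications are traced back to members of `Γ`; those from `es`
  -- hold by assumption and add nothing to `xs`.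
  reduce : ∀ {φs} → All T φs → ∃ λ xs → All Γ xs ×
    (∀ w → Respects (_∈ᴸ xs) w → All (w ⊩_) es → All (w ⊩_) φs)
  reduce [] = [] , [] , λ _ _ _ → []
  reduce (t ∷ ts) with reduce ts
  reduce (inj₁ (A , B , Γ∋ , refl) ∷ ts) | xs , Γxs , sat =
    (A ≺ B) ∷ xs , Γ∋ ∷ Γxs , λ w resp w⊩es →
      resp A B (here refl) ∷ sat w (λ C D → resp C D ∘ there) w⊩es
  reduce (inj₂ φ∈es ∷ ts) | xs , Γxs , sat =
    xs , Γxs , λ w resp w⊩es → All.lookup w⊩es φ∈es ∷ sat w resp w⊩es

  model : ∃ λ w → ∀ φ → φ ∈ T → w ⊩ φ
  model = compactness em ext T λ φs Tφs →
    let xs , Γxs , sat = reduce Tφs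
        w , resp , w⊩es = finSat xs Γxs
    in w , sat w resp w⊩es

  w : Valuation Var
  w = proj₁ model

  w⊩ : ∀ φ → φ ∈ T → w ⊩ φ
  w⊩ = proj₂ model

theorem4 : ∀ {ℓ} → ExcludedMiddle ℓ → Extensionality ℓ ℓ →
    (Var : Set ℓ) → Infinite Var →
    (Γ : STheory Var) →
    (∀ (Δ : STheory Var) → FiniteSubset Δ → Δ ⊆ Γ → Satisfiable Δ) →
    Satisfiable Γ
theorem4 {ℓ} em ext Var _ Γ finSat = R , satisfies
  where
  finite-frame : ∀ {xs} → All Γ xs → Satisfiable (_∈ᴸ xs)
  finite-frame {xs} Γxs = finSat (_∈ᴸ xs) (xs , id , id) (All.lookup Γxs)

  world : ∃ λ w → Respects Γ w × All (w ⊩_) []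
  world = respects-compactness em ext Γ [] λ xs Γxs →
    let S , S⊨ = finite-frame Γxs
        w , w∈S = nonempty S
    in w , (λ A B ∈xs → S⊨ (A ≺ B) ∈xs w w∈S) , []

  R : Frame Var
  R = record { worlds = Respects Γ ; nonempty = proj₁ world , proj₁ (proj₂ world) }

  counterexample : ∀ {A B} → (A ⊀ B) ∈ Γ →
    ∃ λ w → Respects Γ w × All (w ⊩_) (A ∷ (¬̇ B) ∷ [])
  counterexample {A} {B} Γ∋ = respects-compactness em ext Γ _ λ xs Γxs →
    -- With `A ⊀ B` added to the finite part, its frame must supply a world with `A` true and `B`
    -- false that also respects the implications in `xs`.
    let S , S⊨ = finite-frame (Γ∋ ∷ Γxs)
        w , w∈S , wA , wB = S⊨ (A ⊀ B) (here refl)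
    in w , (λ C D ∈xs → S⊨ (C ≺ D) (there ∈xs) w w∈S) , wA ∷ cong not wB ∷ []

  satisfies : R ⊨ᵀ Γ
  satisfies (A ≺ B) Γ∋ w resp = resp A B Γ∋
  satisfies (A ⊀ B) Γ∋ =
    let w , resp , w⊩es = counterexample Γ∋
    in w , resp , All.head w⊩es , not-injective (All.head (All.tail w⊩es))
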